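{- Let $n$ be a positive integer, and suppose there exists a hexagonal permutation $\pi$ with $n$ dots. Then $n$ is odd, and the dots of $\pi$ are contained in a Lee sphere of radius $(n-1)/2$.
   Context: Model the cells (hexagons) of the hexagonal grid by $\mathbb{Z}^2$, where cell $(x,y)$ is adjacent to the six cells $(x\pm1,y)$, $(x,y\pm1)$, $(x+1,y+1)$, $(x-1,y-1)$. The "rows" of the hexagonal grid in its three natural directions are the sets $\{y=c\}$, $\{x=c\}$ and $\{x-y=c\}$ for $c\in\mathbb{Z}$; two rows of the same direction are consecutive if their constants $c$ differ by $1$. A set of dots is a finite nonempty set of cells. A hexagonal permutation with $n$ dots is a set $\pi$ of $n$ cells such that, for each of the three directions, the rows of that direction containing a dot of $\pi$ are exactly $n$ consecutive rows, and each of these rows contains exactly one dot of $\pi$. The distance between two cells is the length of a shortest path of successively adjacent cells joining them; for cells $(x,y)$ and $(a,b)$ it equals $\max(|x-a|,|y-b|,|(x-a)-(y-b)|)$. A Lee sphere of radius $r$ with centre $(a,b)$ is the set of all cells at distance at most $r$ from $(a,b)$. -}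

module Defs where

open import Data.Integer using (ℤ; +_; _+_; _-_; _≤_; _<_)
open import Data.List using (List; []; _∷_; length)
open import Data.List.Membership.Propositional using (_∈_)
open import Data.List.Relation.Unary.Unique.Propositional using (Unique)
open import Data.Nat as ℕ using (ℕ; zero; suc)
open import Data.Product using (_×_; _,_; ∃; ∃!)
open import Function.Bundles using (_⇔_)
open import Level using (0ℓ)
open import Relation.Binary.PropositionalEquality using (_≡_)
open import Relation.Unary using (Pred)

Cell : Set
Cell = ℤ × ℤ

neighbours : Cell → List Cell
neighbours (x , y) =
    (x + + 1 , y      )
  ∷ (x - + 1 , y      )
  ∷ (x       , y + + 1)
  ∷ (x       , y - + 1)
  ∷ (x + + 1 , y + + 1)
  ∷ (x - + 1 , y - + 1)
  ∷ []

Adjacent : Cell → Cell → Set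
Adjacent c d = d ∈ neighbours c

-- Cells may repeat along a path; this does not affect shortest lengths.
data Path : ℕ → Cell → Cell → Set where
  []  : ∀ {c} → Path zero c c
  _∷_ : ∀ {k c d e} → Adjacent c d → Path k d e → Path (suc k) c e

IsDistance : Cell → Cell → ℕ → Set
IsDistance c d k = Path k c d × (∀ m → Path m c d → k ℕ.≤ m)

LeeSphere : (centre : Cell) (radius : ℕ) → Pred Cell 0ℓ
LeeSphere centre r c = ∃ λ k → IsDistance centre c k × k ℕ.≤ r

data Direction : Set where
  constant-y constant-x constant-x-y : Direction

rowOf : Direction → Cell → ℤ
rowOf constant-y   (x , y) = y
rowOf constant-x   (x , y) = x
rowOf constant-x-y (x , y) = x - y

Row : Direction → ℤ → Pred Cell 0ℓ
Row δ c p = rowOf δ p ≡ c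

-- A finite set of cells is given by a duplicate-free list of its elements.
-- In each direction the occupied rows are a, a + 1, …, a + n - 1.
record IsHexagonalPermutation (n : ℕ) (π : List Cell) : Set where
  field
    unique : Unique π
    size   : length π ≡ n
    rows   : ∀ δ → ∃ λ a →
      (∀ c → (∃ λ p → p ∈ π × Row δ c p) ⇔ (a ≤ c × c < a + + n)) ×
      (∀ c → a ≤ c → c < a + + n → ∃! _≡_ λ p → p ∈ π × Row δ c p)

{-# OPTIONS --safe #-}
-- The dots occupy rows a, …, a + n - 1 in the direction y, b, …, b + n - 1 in
-- the direction x and c, …, c + n - 1 in the direction x - y.  Summing x, y
-- and x - y over all dots and subtracting gives 2 (b - a - c) = n - 1, so n is
-- odd, and with r = b - a - c the cell (b + r , a + r) lies on the middle row
-- in all three directions.  Since the distance of two cells is the largest of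
-- the three row differences, every dot is at distance at most r from it.
module Submission where

open import Defs
open import Data.List using (List)
open import Data.List.Membership.Propositional using (_∈_)
open import Data.Nat using (ℕ; NonZero; parity; _∸_; _/_)
open import Data.Parity using (1ℙ)
open import Data.Product using (_×_; ∃)
open import Relation.Binary.PropositionalEquality using (_≡_)
open import Relation.Unary using (_⊆_)

open import Data.Integer as ℤ using (ℤ; +_; -[1+_]; 0ℤ; 1ℤ; -1ℤ; _+_; _-_; _*_; -_; ∣_∣; _⊖_)
import Data.Integer.Properties as ℤ
open import Algebra.Properties.AbelianGroup ℤ.+-0-abelianGroup using (∙-cancelˡ)
open import Data.Integer.Tactic.RingSolver using (solve-∀)
open import Data.List using ([]; _∷_; map; foldr; applyUpTo)
open import Data.List.Membership.Propositional.Properties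
  using (∈-map⁺; ∈-map⁻; ∈-applyUpTo⁺; ∈-applyUpTo⁻)
open import Data.List.Membership.Propositional.Properties.WithK using (unique∧set⇒bag)
open import Data.List.Relation.Binary.BagAndSetEquality using (∼bag⇒↭)
open import Data.List.Relation.Binary.Permutation.Propositional using (_↭_; ↭⇒↭ₛ)
open import Data.List.Relation.Binary.Permutation.Propositional.Properties using (∈-resp-↭)
import Data.List.Relation.Binary.Permutation.Setoid.Properties as Permutation
open import Data.List.Relation.Unary.All as All using (All; all?)
import Data.List.Relation.Unary.All.Properties as All
open import Data.List.Relation.Unary.AllPairs using ([]; _∷_)
open import Data.List.Relation.Unary.Any using (here; there)
open import Data.List.Relation.Unary.Unique.Propositional using (Unique)
open import Data.List.Relation.Unary.Unique.Propositional.Properties using (applyUpTo⁺₁)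
open import Data.Nat as ℕ using (zero; suc; s≤s)
import Data.Nat.DivMod as ℕ
import Data.Nat.Properties as ℕ
import Data.Nat.Tactic.RingSolver as ℕ
open import Data.Product using (_,_; proj₁; proj₂)
open import Data.Sum using (inj₁; inj₂)
open import Function using (_∘_; _⇔_; mk⇔; Equivalence)
open import Relation.Binary.PropositionalEquality
  using (refl; sym; trans; cong; cong₂; subst; setoid; module ≡-Reasoning)
open import Relation.Nullary.Decidable using (from-yes)

-- Cells as vectors, rows as linear forms

infixl 6 _⊕_
infixl 7 _·_

_⊕_ : Cell → Cell → Cell
(x , y) ⊕ (u , v) = x + u , y + v

_·_ : ℕ → Cell → Cell
k · (u , v) = + k * u , + k * v

origin : Cell
origin = 0ℤ , 0ℤ

rowOf-⊕ : ∀ δ c d → rowOf δ (c ⊕ d) ≡ rowOf δ c + rowOf δ d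
rowOf-⊕ constant-y   _ _ = refl
rowOf-⊕ constant-x   _ _ = refl
rowOf-⊕ constant-x-y (x , y) (u , v) = lemma x y u v
  where
  lemma : ∀ x y u v → (x + u) - (y + v) ≡ (x - y) + (u - v)
  lemma = solve-∀

rowOf-· : ∀ δ k d → rowOf δ (k · d) ≡ + k * rowOf δ d
rowOf-· constant-y   _ _ = refl
rowOf-· constant-x   _ _ = refl
rowOf-· constant-x-y k (u , v) = lemma (+ k) u v
  where
  lemma : ∀ k u v → k * u - k * v ≡ k * (u - v)
  lemma = solve-∀

-- Adjacency is translation invariant. This reduces it to the six steps out of `origin`, on which
-- claims about rows are decided by evaluation.
neighbours-⊕ : ∀ c → neighbours c ≡ map (c ⊕_) (neighbours origin)
neighbours-⊕ (x , y) rewrite ℤ.+-identityʳ x | ℤ.+-identityʳ y = refl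

adjacent-⊕ : ∀ c {s} → s ∈ neighbours origin → Adjacent c (c ⊕ s)
adjacent-⊕ c {s} s∈ = subst (c ⊕ s ∈_) (sym (neighbours-⊕ c)) (∈-map⁺ (c ⊕_) s∈)

adjacent⁻ : ∀ {c d} → Adjacent c d → ∃ λ s → s ∈ neighbours origin × d ≡ c ⊕ s
adjacent⁻ {c} {d} cd = ∈-map⁻ (c ⊕_) (subst (d ∈_) (neighbours-⊕ c) cd)

∣rowOf-step∣≤1 : ∀ δ → All (λ s → ∣ rowOf δ s ∣ ℕ.≤ 1) (neighbours origin)
∣rowOf-step∣≤1 constant-y   = from-yes (all? (λ s → ∣ rowOf constant-y s ∣ ℕ.≤? 1) (neighbours origin))
∣rowOf-step∣≤1 constant-x   = from-yes (all? (λ s → ∣ rowOf constant-x s ∣ ℕ.≤? 1) (neighbours origin))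
∣rowOf-step∣≤1 constant-x-y = from-yes (all? (λ s → ∣ rowOf constant-x-y s ∣ ℕ.≤? 1) (neighbours origin))

-- Row differences as lower bounds for path lengths

rowDifference : Direction → Cell → Cell → ℕ
rowDifference δ c d = ∣ rowOf δ d - rowOf δ c ∣

rowDifference-⊕ : ∀ δ c v → rowDifference δ c (c ⊕ v) ≡ ∣ rowOf δ v ∣
rowDifference-⊕ δ c v = cong ∣_∣ (begin
  rowOf δ (c ⊕ v) - rowOf δ c         ≡⟨ cong (_- rowOf δ c) (rowOf-⊕ δ c v) ⟩
  rowOf δ c + rowOf δ v - rowOf δ c   ≡⟨ lemma (rowOf δ c) (rowOf δ v) ⟩
  rowOf δ v                           ∎)
  where
  open ≡-Reasoning
  lemma : ∀ i j → i + j - i ≡ j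
  lemma = solve-∀

-- One step changes a row number by at most 1, and the triangle inequality adds up these changes
-- along the path.
rowDifference≤pathLength : ∀ δ {m c d} → Path m c d → rowDifference δ c d ℕ.≤ m
rowDifference≤pathLength δ {c = c} [] = ℕ.≤-reflexive (cong ∣_∣ (ℤ.+-inverseʳ (rowOf δ c)))
rowDifference≤pathLength δ {c = c} {d} (_∷_ {k = k} {d = e} ce p)
  with s , s∈ , refl ← adjacent⁻ ce = begin
  ∣ rowOf δ d - rowOf δ c ∣
    ≡⟨ cong ∣_∣ (ℤ.+-minus-telescope (rowOf δ d) (rowOf δ e) (rowOf δ c)) ⟨
  ∣ (rowOf δ d - rowOf δ e) + (rowOf δ e - rowOf δ c) ∣
    ≤⟨ ℤ.∣i+j∣≤∣i∣+∣j∣ (rowOf δ d - rowOf δ e) (rowOf δ e - rowOf δ c) ⟩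
  rowDifference δ e d ℕ.+ rowDifference δ c e
    ≤⟨ ℕ.+-mono-≤ (rowDifference≤pathLength δ p) step ⟩
  k ℕ.+ 1
    ≡⟨ ℕ.+-comm k 1 ⟩
  suc k ∎
  where
  open ℕ.≤-Reasoning
  step : rowDifference δ c (c ⊕ s) ℕ.≤ 1
  step = subst (ℕ._≤ 1) (sym (rowDifference-⊕ δ c s)) (All.lookup (∣rowOf-step∣≤1 δ) s∈)

-- Shortest paths and the distance

_++ₚ_ : ∀ {j k c d e} → Path j c d → Path k d e → Path (j ℕ.+ k) c e
[]       ++ₚ q = q
(cd ∷ p) ++ₚ q = cd ∷ (p ++ₚ q)

straightPath : ∀ {s} → s ∈ neighbours origin → ∀ k c → Path k c (c ⊕ k · s)
straightPath {u , v} s∈ zero c@(x , y) =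
  subst (Path 0 c) (sym (cong₂ _,_ (ℤ.+-identityʳ x) (ℤ.+-identityʳ y))) []
straightPath {u , v} s∈ (suc k) c@(x , y) =
  adjacent-⊕ c s∈ ∷ subst (Path k (c ⊕ (u , v))) (cong₂ _,_ (lemma x (+ k) u) (lemma y (+ k) v))
    (straightPath s∈ k (c ⊕ (u , v)))
  where
  lemma : ∀ x k u → x + u + k * u ≡ x + (1ℤ + k) * u
  lemma = solve-∀

-- The six sectors spanned by two consecutive unit steps; within a sector some
-- direction sees every step crossing one row, always the same way.
data Sector : Cell → Set where
  sector : ∀ δ {s t} → s ∈ neighbours origin → t ∈ neighbours origin →
    rowOf δ s ≡ rowOf δ t → ∣ rowOf δ s ∣ ≡ 1 → ∀ j k {v} → v ≡ j · s ⊕ k · t → Sector v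

pattern +x  = here refl
pattern -x  = there (here refl)
pattern +y  = there (there (here refl))
pattern -y  = there (there (there (here refl)))
pattern +xy = there (there (there (there (here refl))))
pattern -xy = there (there (there (there (there (here refl)))))

-- The signs of the coordinates decide the sector. When they agree, the smaller absolute value
-- counts the diagonal steps and the remainder `k` is walked along one axis; otherwise both kinds of
-- step are axial.
inSector : ∀ v → Sector v
inSector (+ i , + j) with ℕ.≤-total i j
... | inj₁ i≤j with k , refl ← ℕ.m≤n⇒∃[o]m+o≡n i≤j =
  sector constant-y +xy +y refl refl i k (cong₂ _,_ (p (+ i) (+ k)) (q (+ i) (+ k)))
  where
  p : ∀ i k → i ≡ i * 1ℤ + k * 0ℤ
  p = solve-∀
  q : ∀ i k → i + k ≡ i * 1ℤ + k * 1ℤ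
  q = solve-∀
... | inj₂ j≤i with k , refl ← ℕ.m≤n⇒∃[o]m+o≡n j≤i =
  sector constant-x +xy +x refl refl j k (cong₂ _,_ (p (+ j) (+ k)) (q (+ j) (+ k)))
  where
  p : ∀ j k → j + k ≡ j * 1ℤ + k * 1ℤ
  p = solve-∀
  q : ∀ j k → j ≡ j * 1ℤ + k * 0ℤ
  q = solve-∀
inSector (-[1+ i ] , -[1+ j ]) with ℕ.≤-total i j
... | inj₁ i≤j with k , refl ← ℕ.m≤n⇒∃[o]m+o≡n i≤j =
  -- `-[1+ i ]` is `- + suc i`, so the coefficient is `suc i`; the shift leaves the difference `k`
  -- unchanged.
  sector constant-y -xy -y refl refl (suc i) k
    (cong₂ _,_ (p (+ suc i) (+ k)) (q (+ suc i) (+ k)))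
  where
  p : ∀ i k → - i ≡ i * -1ℤ + k * 0ℤ
  p = solve-∀
  q : ∀ i k → - (i + k) ≡ i * -1ℤ + k * -1ℤ
  q = solve-∀
... | inj₂ j≤i with k , refl ← ℕ.m≤n⇒∃[o]m+o≡n j≤i =
  sector constant-x -xy -x refl refl (suc j) k
    (cong₂ _,_ (p (+ suc j) (+ k)) (q (+ suc j) (+ k)))
  where
  p : ∀ j k → - (j + k) ≡ j * -1ℤ + k * -1ℤ
  p = solve-∀
  q : ∀ j k → - j ≡ j * -1ℤ + k * 0ℤ
  q = solve-∀
inSector (+ i , -[1+ j ]) =
  sector constant-x-y +x -y refl refl i (suc j)
    (cong₂ _,_ (p (+ i) (+ suc j)) (q (+ i) (+ suc j)))
  where
  p : ∀ i j → i ≡ i * 1ℤ + j * 0ℤ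
  p = solve-∀
  q : ∀ i j → - j ≡ i * 0ℤ + j * -1ℤ
  q = solve-∀
inSector (-[1+ i ] , + j) =
  sector constant-x-y -x +y refl refl (suc i) j
    (cong₂ _,_ (p (+ suc i) (+ j)) (q (+ suc i) (+ j)))
  where
  p : ∀ i j → - i ≡ i * -1ℤ + j * 0ℤ
  p = solve-∀
  q : ∀ i j → j ≡ i * 0ℤ + j * 1ℤ
  q = solve-∀

-- Walk `j` steps `s`, then `k` steps `t`. As `rowOf δ` is linear with the same value 1 or -1 on
-- both, no row change cancels, and the length is the row difference for `δ`.
path-⊕ : ∀ c {v} → Sector v → ∃ λ δ → Path (rowDifference δ c (c ⊕ v)) c (c ⊕ v)
path-⊕ c (sector δ {s} {t} s∈ t∈ same unit j k refl) =
  δ , subst (λ m → Path m c (c ⊕ (j · s ⊕ k · t))) (sym length≡)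
        (subst (Path (j ℕ.+ k) c) (⊕-assoc c (j · s) (k · t))
          (straightPath s∈ j c ++ₚ straightPath t∈ k (c ⊕ j · s)))
  where
  open ≡-Reasoning
  ⊕-assoc : ∀ c d e → c ⊕ d ⊕ e ≡ c ⊕ (d ⊕ e)
  ⊕-assoc (x , y) (u , v) (p , q) = cong₂ _,_ (ℤ.+-assoc x u p) (ℤ.+-assoc y v q)
  length≡ : rowDifference δ c (c ⊕ (j · s ⊕ k · t)) ≡ j ℕ.+ k
  length≡ = begin
    rowDifference δ c (c ⊕ (j · s ⊕ k · t))  ≡⟨ rowDifference-⊕ δ c (j · s ⊕ k · t) ⟩
    ∣ rowOf δ (j · s ⊕ k · t) ∣              ≡⟨ cong ∣_∣ (rowOf-⊕ δ (j · s) (k · t)) ⟩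
    ∣ rowOf δ (j · s) + rowOf δ (k · t) ∣
      ≡⟨ cong ∣_∣ (cong₂ _+_ (rowOf-· δ j s) (rowOf-· δ k t)) ⟩
    ∣ + j * rowOf δ s + + k * rowOf δ t ∣
      ≡⟨ cong (λ z → ∣ + j * rowOf δ s + + k * z ∣) same ⟨
    ∣ + j * rowOf δ s + + k * rowOf δ s ∣
      ≡⟨ cong ∣_∣ (ℤ.*-distribʳ-+ (rowOf δ s) (+ j) (+ k)) ⟨
    ∣ + (j ℕ.+ k) * rowOf δ s ∣              ≡⟨ ℤ.abs-* (+ (j ℕ.+ k)) (rowOf δ s) ⟩
    (j ℕ.+ k) ℕ.* ∣ rowOf δ s ∣              ≡⟨ cong ((j ℕ.+ k) ℕ.*_) unit ⟩
    (j ℕ.+ k) ℕ.* 1                          ≡⟨ ℕ.*-identityʳ (j ℕ.+ k) ⟩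
    j ℕ.+ k                                  ∎

-- The lower bound holds in every direction and is attained in the direction supplied by the sector,
-- so that row difference is the largest of the three.
isDistance : ∀ c d → ∃ λ δ → IsDistance c d (rowDifference δ c d)
isDistance c@(x , y) d@(u , v) with path-⊕ c (inSector (u - x , v - y))
... | δ , p = δ , subst (λ e → Path (rowDifference δ c e) c e) (cong₂ _,_ (lemma x u) (lemma y v)) p
                , λ _ → rowDifference≤pathLength δ
  where
  lemma : ∀ x u → x + (u - x) ≡ u
  lemma = solve-∀

-- The distance is one of the three row differences, so their maximum never has to be formed.
leeSphere⁺ : ∀ {c d r} → (∀ δ → rowDifference δ c d ℕ.≤ r) → LeeSphere c r d
leeSphere⁺ {c} {d} bound with δ , dist ← isDistance c d = _ , dist , bound δ

-- Integer intervals and their sums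

interval : ℤ → ℕ → List ℤ
interval a = applyUpTo (λ i → a + + i)

interval-unique : ∀ a n → Unique (interval a n)
interval-unique a n = applyUpTo⁺₁ (λ i → a + + i) n λ i<j _ eq →
  ℕ.<⇒≢ i<j (ℤ.+-injective (∙-cancelˡ a _ _ eq))

∈-interval : ∀ {a n z} → (a ℤ.≤ z × z ℤ.< a + + n) ⇔ z ∈ interval a n
∈-interval {a} {n} {z} = mk⇔ to from
  where
  add-diff : ∀ a z → a + (z - a) ≡ z
  add-diff = solve-∀
  to : a ℤ.≤ z × z ℤ.< a + + n → z ∈ interval a n
  to (a≤z , z<a+n) = subst (_∈ interval a n) a+i≡z (∈-applyUpTo⁺ _ i<n)
    where
    -- By `a≤z` this absolute value is the true offset of `z` from `a`.
    i = ∣ z - a ∣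
    a+i≡z : a + + i ≡ z
    a+i≡z = trans (cong (λ w → a + w) (ℤ.0≤i⇒+∣i∣≡i (ℤ.i≤j⇒0≤j-i a≤z))) (add-diff a z)
    i<n : i ℕ.< n
    i<n = ℕ.≰⇒> λ n≤i →
      ℤ.<⇒≱ z<a+n (subst (a + + n ℤ.≤_) a+i≡z (ℤ.+-monoʳ-≤ a (ℤ.+≤+ n≤i)))
  from : z ∈ interval a n → a ℤ.≤ z × z ℤ.< a + + n
  from z∈ with i , i<n , refl ← ∈-applyUpTo⁻ _ z∈ =
    ℤ.i≤i+j a (+ i) , ℤ.+-monoʳ-< a (ℤ.+<+ i<n)

sum : List ℤ → ℤ
sum = foldr _+_ 0ℤ

sum-↭ : ∀ {xs ys} → xs ↭ ys → sum xs ≡ sum ys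
sum-↭ = Permutation.foldr-commMonoid (setoid ℤ) ℤ.+-0-isCommutativeMonoid ∘ ↭⇒↭ₛ

-- The arithmetic series, doubled to avoid a division by 2.
sum-interval : ∀ a n → sum (interval a n) + sum (interval a n) ≡ + n * (a + a + + n - 1ℤ)
sum-interval a n = go n a λ _ → refl
  where
  step : ∀ a n s → (a + 0ℤ + s) + (a + 0ℤ + s) ≡ a + a + (s + s)
  step = solve-∀
  close : ∀ a n → a + a + n * (a + 1ℤ + (a + 1ℤ) + n - 1ℤ) ≡ (1ℤ + n) * (a + a + (1ℤ + n) - 1ℤ)
  close = solve-∀
  -- Generalised over pointwise equal sequences, as shifting the index of
  -- λ i → a + + i does not give λ i → (a + 1ℤ) + + i definitionally.
  go : ∀ n a {f} → (∀ i → f i ≡ a + + i) →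
    sum (applyUpTo f n) + sum (applyUpTo f n) ≡ + n * (a + a + + n - 1ℤ)
  go zero    a f≡ = refl
  go (suc n) a {f} f≡ rewrite f≡ 0 = begin
    (a + 0ℤ + s) + (a + 0ℤ + s)                 ≡⟨ step a (+ n) s ⟩
    a + a + (s + s)                             ≡⟨ cong (λ z → a + a + z) (go n (a + 1ℤ) shift) ⟩
    a + a + + n * (a + 1ℤ + (a + 1ℤ) + + n - 1ℤ)  ≡⟨ close a (+ n) ⟩
    + suc n * (a + a + + suc n - 1ℤ)            ∎
    where
    open ≡-Reasoning
    s = sum (applyUpTo (f ∘ suc) n)
    shift : ∀ i → f (suc i) ≡ a + 1ℤ + + i
    shift i = trans (f≡ (suc i)) (sym (ℤ.+-assoc a 1ℤ (+ i)))

-- Row sums over the dots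

sum-x-y : ∀ π → sum (map (rowOf constant-x) π) ≡
  sum (map (rowOf constant-y) π) + sum (map (rowOf constant-x-y) π)
sum-x-y []            = refl
sum-x-y ((x , y) ∷ π) rewrite sum-x-y π = lemma x y _ _
  where
  lemma : ∀ x y s t → x + (s + t) ≡ (y + s) + ((x - y) + t)
  lemma = solve-∀

-- Injectivity is asked only on members of `xs`: `rowOf δ` separates the dots of a hexagonal
-- permutation, but not arbitrary cells.
map-unique : ∀ {A B : Set} {f : A → B} {xs} →
  (∀ {x y} → x ∈ xs → y ∈ xs → f x ≡ f y → x ≡ y) → Unique xs → Unique (map f xs)
map-unique inj []         = []
map-unique inj (x∉ ∷ xs!) =
  All.map⁺ (All.tabulate λ y∈ → All.lookup x∉ y∈ ∘ inj (here refl) (there y∈))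
  ∷ map-unique (λ x∈ y∈ → inj (there x∈) (there y∈)) xs!

module _ {n π} (hex : IsHexagonalPermutation n π) where
  open IsHexagonalPermutation hex

  firstRow : Direction → ℤ
  firstRow δ = proj₁ (rows δ)

  -- Two duplicate-free lists with the same members are permutations of each other. The list of rows
  -- has no duplicates because each occupied row holds a single dot.
  rows-↭ : ∀ δ → map (rowOf δ) π ↭ interval (firstRow δ) n
  rows-↭ δ with a , occupied , once ← rows δ =
    ∼bag⇒↭ (unique∧set⇒bag (map-unique injective unique) (interval-unique a n) (mk⇔ to from))
    where
    injective : ∀ {p q} → p ∈ π → q ∈ π → rowOf δ p ≡ rowOf δ q → p ≡ q
    injective p∈ q∈ eq
      with a≤ , <a+n ← Equivalence.to (occupied _) (_ , p∈ , refl)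
      with _ , _ , only ← once _ a≤ <a+n =
      trans (sym (only (p∈ , refl))) (only (q∈ , sym eq))
    to : ∀ {z} → z ∈ map (rowOf δ) π → z ∈ interval a n
    to z∈ with p , p∈ , z≡ ← ∈-map⁻ (rowOf δ) z∈ =
      Equivalence.to ∈-interval (Equivalence.to (occupied _) (p , p∈ , sym z≡))
    from : ∀ {z} → z ∈ interval a n → z ∈ map (rowOf δ) π
    from z∈ with p , p∈ , refl ← Equivalence.from (occupied _) (Equivalence.from ∈-interval z∈) =
      ∈-map⁺ (rowOf δ) p∈

  twice-sum : ∀ δ → let s = sum (map (rowOf δ) π); a = firstRow δ in
    s + s ≡ + n * (a + a + + n - 1ℤ)
  twice-sum δ = trans (cong (λ s → s + s) (sum-↭ (rows-↭ δ))) (sum-interval (firstRow δ) n)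

  -- The cell on the first row in the directions `constant-x` and `constant-y` lies this many rows
  -- past the first row in the direction `constant-x-y`.
  excess : ℤ
  excess = firstRow constant-x - firstRow constant-y - firstRow constant-x-y

  -- All three doubled sums carry the factor `+ n`; cancelling it, as `n` is nonzero, leaves a
  -- linear relation between the first rows.
  twice-excess : .{{_ : NonZero n}} → excess + excess ≡ + n - 1ℤ
  twice-excess = begin
    -- Expanded so that `cancelled` makes everything but the last bracket vanish.
    excess + excess           ≡⟨ expand a b c (+ n) ⟩
    (b + b + + n - 1ℤ) - (a + a + + n - 1ℤ + (c + c + + n - 1ℤ)) + (+ n - 1ℤ)
      ≡⟨ cong (λ z → z - (a + a + + n - 1ℤ + (c + c + + n - 1ℤ)) + (+ n - 1ℤ)) cancelled ⟩
    (a + a + + n - 1ℤ + (c + c + + n - 1ℤ)) - (a + a + + n - 1ℤ + (c + c + + n - 1ℤ)) + (+ n - 1ℤ)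
      ≡⟨ cong (_+ (+ n - 1ℤ)) (ℤ.+-inverseʳ (a + a + + n - 1ℤ + (c + c + + n - 1ℤ))) ⟩
    0ℤ + (+ n - 1ℤ)           ≡⟨ ℤ.+-identityˡ (+ n - 1ℤ) ⟩
    + n - 1ℤ                  ∎
    where
    open ≡-Reasoning
    a = firstRow constant-y
    b = firstRow constant-x
    c = firstRow constant-x-y
    s = sum (map (rowOf constant-y) π)
    t = sum (map (rowOf constant-x-y) π)
    expand : ∀ a b c n → (b - a - c) + (b - a - c) ≡
      (b + b + n - 1ℤ) - (a + a + n - 1ℤ + (c + c + n - 1ℤ)) + (n - 1ℤ)
    expand = solve-∀
    double-+ : ∀ s t → (s + t) + (s + t) ≡ (s + s) + (t + t)
    double-+ = solve-∀
    cancelled : b + b + + n - 1ℤ ≡ a + a + + n - 1ℤ + (c + c + + n - 1ℤ)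
    cancelled = ℤ.*-cancelˡ-≡ (+ n) _ _ (begin
      + n * (b + b + + n - 1ℤ)      ≡⟨ twice-sum constant-x ⟨
      _                             ≡⟨ cong (λ z → z + z) (sum-x-y π) ⟩
      (s + t) + (s + t)             ≡⟨ double-+ s t ⟩
      (s + s) + (t + t)             ≡⟨ cong₂ _+_ (twice-sum constant-y) (twice-sum constant-x-y) ⟩
      + n * (a + a + + n - 1ℤ) + + n * (c + c + + n - 1ℤ)
        ≡⟨ ℤ.*-distribˡ-+ (+ n) (a + a + + n - 1ℤ) (c + c + + n - 1ℤ) ⟨
      + n * (a + a + + n - 1ℤ + (c + c + + n - 1ℤ))  ∎)

  -- The centre and the radius

  middleCell : ℕ → Cell
  middleCell r = firstRow constant-x + + r , firstRow constant-y + + r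

  dot-row : ∀ δ {p} → p ∈ π → ∃ λ i → i ℕ.< n × rowOf δ p ≡ firstRow δ + + i
  dot-row δ p∈ = ∈-applyUpTo⁻ _ (∈-resp-↭ (rows-↭ δ) (∈-map⁺ (rowOf δ) p∈))

∣i⊖r∣≤r : ∀ {i r} → i ℕ.≤ r ℕ.+ r → ∣ i ⊖ r ∣ ℕ.≤ r
∣i⊖r∣≤r {i} {r} i≤2r with ℕ.≤-total i r
... | inj₁ i≤r = ℕ.≤-trans (ℕ.≤-reflexive (ℤ.∣⊖∣-≤ i≤r)) (ℕ.m∸n≤m r i)
... | inj₂ r≤i = ℕ.≤-trans (ℕ.≤-reflexive (trans (ℤ.∣m⊖n∣≡∣n⊖m∣ i r) (ℤ.∣⊖∣-≤ r≤i)))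
                           (ℕ.m≤n+o⇒m∸n≤o i r i≤2r)

inLeeSphere : ∀ {r π} (hex : IsHexagonalPermutation (suc (r ℕ.+ r)) π) → excess hex ≡ + r →
  (_∈ π) ⊆ LeeSphere (middleCell hex r) r
inLeeSphere {r} hex excess≡r {p} p∈ = leeSphere⁺ bound
  where
  first : Direction → ℤ
  first = firstRow hex
  centre : Cell
  centre = middleCell hex r
  middle : ∀ δ → rowOf δ centre ≡ first δ + + r
  middle constant-y   = refl
  middle constant-x   = refl
  -- The two offsets `+ r` cancel, leaving `b - a`, which is `c` plus the excess; this is the middle
  -- row because the excess equals `+ r`.
  middle constant-x-y = trans (lemma (first constant-y) (first constant-x) (first constant-x-y) (+ r))
                              (cong (λ w → first constant-x-y + w) excess≡r)
    where
    lemma : ∀ a b c r → (b + r) - (a + r) ≡ c + (b - a - c)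
    lemma = solve-∀
  bound : ∀ δ → rowDifference δ centre p ℕ.≤ r
  -- Matching `s≤s` turns `i < suc (r + r)` into `i ≤ r + r`, so `i` differs from the middle offset
  -- `r` by at most `r`.
  bound δ with i , s≤s i≤2r , row≡ ← dot-row hex δ p∈ = begin
    ∣ rowOf δ p - rowOf δ centre ∣           ≡⟨ cong ∣_∣ (cong₂ _-_ row≡ (middle δ)) ⟩
    ∣ first δ + + i - (first δ + + r) ∣      ≡⟨ cong ∣_∣ (lemma (first δ) (+ i) (+ r)) ⟩
    ∣ + i - + r ∣                            ≡⟨ cong ∣_∣ (ℤ.[+m]-[+n]≡m⊖n i r) ⟩
    ∣ i ⊖ r ∣                                ≤⟨ ∣i⊖r∣≤r i≤2r ⟩
    r                                        ∎
    where
    open ℕ.≤-Reasoning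
    lemma : ∀ a i r → a + i - (a + r) ≡ i - r
    lemma = solve-∀

parity-odd : ∀ r → parity (suc (r ℕ.+ r)) ≡ 1ℙ
parity-odd zero    = refl
parity-odd (suc r) rewrite ℕ.+-suc r r = parity-odd r

half-double : ∀ r → (r ℕ.+ r) / 2 ≡ r
half-double r = trans (cong (_/ 2) (lemma r)) (ℕ.m*n/n≡m r 2)
  where
  lemma : ∀ r → r ℕ.+ r ≡ r ℕ.* 2
  lemma = ℕ.solve-∀

theorem1 : ∀ (n : ℕ) .{{_ : NonZero n}} (π : List Cell) →
    IsHexagonalPermutation n π →
    parity n ≡ 1ℙ ×
    (∃ λ centre → (_∈ π) ⊆ LeeSphere centre ((n ∸ 1) / 2))
theorem1 (suc n) π hex with excess hex in eq | twice-excess hex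
-- `+ suc n - 1ℤ` evaluates to `+ n`, so `refl` replaces `n` by `r + r`. A negative excess would
-- have a negative double, so that case is empty.
... | + r | refl =
  parity-odd r ,
  middleCell hex r ,
  subst (λ m → (_∈ π) ⊆ LeeSphere (middleCell hex r) m) (sym (half-double r)) (inLeeSphere hex eq)
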